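{- Let $k$ be a positive integer. For every integer $n\ge1$, $$D_k^e(n)-D_k^o(n)=\begin{cases}(-1)^m, & \text{if } 1\le n=\tfrac12 m(3m\pm1)\le k-1 \text{ for some integer } m,\\ P_e^{(k)}(d,n)-P_o^{(k)}(d,n), & \text{if } k-1<n\le \tfrac12 k(k-1),\\ 0,&\text{otherwise.}\end{cases}$$
   Context: $D_k(n)$ is the number of partitions of $n$ into non-negative parts (the part $0$ is allowed) in which the smallest part appears exactly $k$ times and no other part is repeated. $D_k^e(n)$ (resp. $D_k^o(n)$) is the number of such partitions in which the number of parts greater than the smallest part is even (resp. odd). $P_e^{(k)}(d,n)$ (resp. $P_o^{(k)}(d,n)$) is the number of partitions of $n$ into an even (resp. odd) number of distinct positive parts, none exceeding $k-1$. -}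

module Defs where

open import Data.List.Base using (List; []; _∷_; length; filter; deduplicate; upTo; cartesianProductWith)
open import Data.List.Membership.DecPropositional using () renaming (_∈?_ to member?)
open import Data.List.Membership.Propositional using (_∈_; find; lose)
open import Data.List.Membership.Propositional.Properties
  using (∈-filter⁺; ∈-filter⁻; ∈-upTo⁺; ∈-cartesianProductWith⁺; ∈-deduplicate⁺; ∈-deduplicate⁻)
open import Data.List.Properties using (≡-dec)
open import Data.List.Relation.Unary.All as All using (All; []; _∷_)
open import Data.List.Relation.Unary.Any as Any using (here; there)
open import Data.List.Relation.Unary.Unique.DecPropositional using (unique?)
open import Data.List.Relation.Unary.Unique.DecPropositional.Properties using (deduplicate-!)
open import Data.List.Relation.Unary.Unique.Propositional using (Unique)
open import Data.List.Relation.Unary.Sorted.TotalOrder using (Sorted; sorted?)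
open import Data.Integer.Base as ℤ using (ℤ; +_)
open import Data.Nat.Base using (ℕ; zero; suc; _+_; _∸_; _≤_; _<_; z≤n; s≤s; parity)
open import Data.Nat.ListAction using (sum)
open import Data.Nat.Properties
open import Data.Parity.Base using (Parity; 0ℙ; 1ℙ)
open import Data.Parity.Properties using () renaming (_≟_ to _≟ℙ_)
open import Data.Product.Base using (∃; _×_; _,_; proj₁; proj₂)
open import Data.Sum.Base using (_⊎_)
open import Function.Base using (_∘_)
open import Function.Bundles using (_⇔_; mk⇔)
open import Relation.Binary.PropositionalEquality using (_≡_; _≢_; refl; sym; subst)
open import Relation.Nullary using (Dec; yes; no)
open import Relation.Nullary.Decidable using (map′; _×-dec_; _→-dec_; ¬?)
open import Relation.Unary using (Decidable)

record Enumeration {A : Set} (P : A → Set) : Set where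
  field
    elements : List A
    unique   : Unique elements
    exact    : ∀ x → x ∈ elements ⇔ P x

  -- Independent of the enumeration chosen, by `unique` and `exact`.
  size : ℕ
  size = length elements

open Enumeration public using (size)

-- The parts are listed in weakly increasing order, so that each partition
-- is represented exactly once; 0 is allowed as a part.
record IsPartition (n : ℕ) (ps : List ℕ) : Set where
  constructor isPartition
  field
    sorted : Sorted ≤-totalOrder ps
    total  : sum ps ≡ n

occurrences : ℕ → List ℕ → ℕ
occurrences x ps = length (filter (x ≟_) ps)

numberAbove : ℕ → List ℕ → ℕ
numberAbove s ps = length (filter (s <?_) ps)

record IsDPartition (k n s : ℕ) (ps : List ℕ) : Set where
  constructor isDPartition
  field
    partition      : IsPartition n ps
    isPart         : s ∈ ps
    smallest       : All (s ≤_) ps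
    smallestTimes  : occurrences s ps ≡ k
    othersOnce     : All (λ x → x ≢ s → occurrences x ps ≤ 1) ps

DPartition : Parity → (k n : ℕ) → List ℕ → Set
DPartition π k n ps =
  ∃ λ s → IsDPartition k n s ps × parity (numberAbove s ps) ≡ π

record DistinctPartition (π : Parity) (k n : ℕ) (ps : List ℕ) : Set where
  constructor distinctPartition
  field
    partition : IsPartition n ps
    positive  : All (1 ≤_) ps
    distinct  : Unique ps
    bounded   : All (_≤ k ∸ 1) ps
    parity≡   : parity (length ps) ≡ π

isPartition? : ∀ n → Decidable (IsPartition n)
isPartition? n ps =
  map′ (λ (a , b) → isPartition a b) (λ (isPartition a b) → a , b)
    (sorted? ≤-totalOrder _≤?_ ps ×-dec sum ps ≟ n)

isDPartition? : ∀ k n s → Decidable (IsDPartition k n s)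
isDPartition? k n s ps =
  map′ (λ (a , b , c , d , e) → isDPartition a b c d e)
       (λ (isDPartition a b c d e) → a , b , c , d , e)
    (isPartition? n ps ×-dec member? _≟_ s ps ×-dec All.all? (s ≤?_) ps ×-dec
     occurrences s ps ≟ k ×-dec
     All.all? (λ x → ¬? (x ≟ s) →-dec (occurrences x ps ≤? 1)) ps)

dPartition? : ∀ π k n → Decidable (DPartition π k n)
dPartition? π k n ps =
  map′ (λ any → let s , _ , p = find any in s , p)
       (λ (s , p) → lose (IsDPartition.isPart (proj₁ p)) p)
    (Any.any? (λ s → isDPartition? k n s ps ×-dec parity (numberAbove s ps) ≟ℙ π) ps)

distinctPartition? : ∀ π k n → Decidable (DistinctPartition π k n)
distinctPartition? π k n ps =
  map′ (λ (a , b , c , d , e) → distinctPartition a b c d e)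
       (λ (distinctPartition a b c d e) → a , b , c , d , e)
    (isPartition? n ps ×-dec All.all? (1 ≤?_) ps ×-dec unique? _≟_ ps ×-dec
     All.all? (_≤? k ∸ 1) ps ×-dec parity (length ps) ≟ℙ π)

boundedLists : (N L : ℕ) → List (List ℕ)
boundedLists N zero    = [] ∷ []
boundedLists N (suc L) = [] ∷ cartesianProductWith _∷_ (upTo (suc N)) (boundedLists N L)

∈-boundedLists : ∀ {N} L {ps} → length ps ≤ L → All (_≤ N) ps → ps ∈ boundedLists N L
∈-boundedLists zero    {[]}     _       _        = here refl
∈-boundedLists (suc L) {[]}     _       _        = here refl
∈-boundedLists (suc L) {p ∷ ps} (s≤s l) (b ∷ bs) =
  there (∈-cartesianProductWith⁺ _∷_ (∈-upTo⁺ (s≤s b)) (∈-boundedLists L l bs))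

enumerate : ∀ {P : List ℕ → Set} → Decidable P → (N L : ℕ) →
            (∀ {ps} → P ps → length ps ≤ L × All (_≤ N) ps) → Enumeration P
enumerate {P} P? N L bound = record
  { elements = deduplicate _≟ˡ_ candidates
  ; unique   = deduplicate-! _≟ˡ_ candidates
  ; exact    = λ ps → mk⇔
      (λ ps∈ → proj₂ (∈-filter⁻ P? {xs = boundedLists N L} (∈-deduplicate⁻ _≟ˡ_ candidates ps∈)))
      (λ p → ∈-deduplicate⁺ _≟ˡ_
        (∈-filter⁺ P? (∈-boundedLists L (proj₁ (bound p)) (proj₂ (bound p))) p))
  }
  where
  _≟ˡ_ = ≡-dec _≟_
  candidates = filter P? (boundedLists N L)

parts≤sum : ∀ ps → All (_≤ sum ps) ps
parts≤sum []       = []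
parts≤sum (p ∷ ps) = m≤m+n p (sum ps) ∷ All.map (λ q≤ → ≤-trans q≤ (m≤n+m (sum ps) p)) (parts≤sum ps)

length≤zeros+sum : ∀ ps → length ps ≤ occurrences 0 ps + sum ps
length≤zeros+sum []           = z≤n
length≤zeros+sum (zero  ∷ ps) = s≤s (length≤zeros+sum ps)
length≤zeros+sum (suc p ∷ ps) = begin
  suc (length ps)                            ≤⟨ s≤s (length≤zeros+sum ps) ⟩
  suc (occurrences 0 ps + sum ps)            ≡⟨ +-suc (occurrences 0 ps) (sum ps) ⟨
  occurrences 0 ps + suc (sum ps)            ≤⟨ +-monoʳ-≤ (occurrences 0 ps) (s≤s (m≤n+m (sum ps) p)) ⟩
  occurrences 0 ps + suc (p + sum ps)        ∎
  where open ≤-Reasoning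

occurrences-positive : ∀ {ps} → All (1 ≤_) ps → occurrences 0 ps ≡ 0
occurrences-positive []             = refl
occurrences-positive (s≤s _ ∷ rest) = occurrences-positive rest

parts≤n : ∀ {n ps} → IsPartition n ps → All (_≤ n) ps
parts≤n {ps = ps} (isPartition _ refl) = parts≤sum ps

length≤ : ∀ {n c ps} → IsPartition n ps → occurrences 0 ps ≤ c → length ps ≤ c + n
length≤ {ps = ps} (isPartition _ refl) zeros≤ =
  ≤-trans (length≤zeros+sum ps) (+-monoˡ-≤ (sum ps) zeros≤)

zeros≤k : ∀ {k n s ps} → IsDPartition k n s ps → occurrences 0 ps ≤ k
zeros≤k {s = zero}  d = ≤-reflexive (IsDPartition.smallestTimes d)
zeros≤k {s = suc _} d =
  subst (_≤ _) (sym (occurrences-positive (All.map (≤-trans (s≤s z≤n)) (IsDPartition.smallest d)))) z≤n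

dPartitions : ∀ π k n → Enumeration (DPartition π k n)
dPartitions π k n = enumerate (dPartition? π k n) n (k + n)
  λ (s , d , _) → length≤ (IsDPartition.partition d) (zeros≤k d) , parts≤n (IsDPartition.partition d)

distinctPartitions : ∀ π k n → Enumeration (DistinctPartition π k n)
distinctPartitions π k n = enumerate (distinctPartition? π k n) n n
  λ d → length≤ (DistinctPartition.partition d)
                (≤-reflexive (occurrences-positive (DistinctPartition.positive d)))
      , parts≤n (DistinctPartition.partition d)

Dᵉ Dᵒ Pₑ Pₒ : (k n : ℕ) → ℕ
Dᵉ k n = size (dPartitions 0ℙ k n)
Dᵒ k n = size (dPartitions 1ℙ k n)
Pₑ k n = size (distinctPartitions 0ℙ k n)
Pₒ k n = size (distinctPartitions 1ℙ k n)

-- n = m(3m ± 1)/2, cleared of the denominator.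
Pentagonal : ℕ → ℤ → Set
Pentagonal n m = + 2 ℤ.* + n ≡ m ℤ.* (+ 3 ℤ.* m ℤ.+ + 1)
               ⊎ + 2 ℤ.* + n ≡ m ℤ.* (+ 3 ℤ.* m ℤ.- + 1)

{-# OPTIONS --safe #-}
module Submission where

-- Classifying by the smallest part s, the generating function of Dᵉ − Dᵒ is
-- F_k = Σ_{s≥0} q^{ks} ∏_{j>s} (1 − q^j). Multiplying the s-th product by 1 − q^s reindexes the sum,
-- so F_k − F_{k+1} = q^k F_k, while F_1 telescopes to 1; hence F_k = ∏_{j<k} (1 − q^j), which is the
-- generating function of Pₑ − Pₒ and has degree k(k − 1)/2. Its coefficients up to q^{k−1} are
-- pentagonal by Shanks' finite identity
--   Σ_{s=0}^{n} (−1)^s q^{sn+s(s+1)/2} ∏_{j=s+1}^{n} (1 − q^j)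
--     = 1 + Σ_{j=1}^{n} (−1)^j (q^{j(3j+1)/2} + q^{j(3j−1)/2}),
-- whose left-hand side agrees with its term s = 0 up to q^n.

open import Defs
open import Data.Empty using (⊥)
open import Data.Integer.Base as ℤ using (ℤ; +_; -[1+_]; _-_; _^_; ∣_∣; 0ℤ; 1ℤ; -1ℤ)
import Data.Integer.Properties as ℤ
open import Data.Integer.Tactic.RingSolver using () renaming (solve-∀ to solve-ℤ)
open import Data.List.Base using (List; []; _∷_; _++_; length; map; replicate)
open import Data.List.Membership.Propositional using (_∈_)
open import Data.List.Membership.Propositional.Properties
  using (∈-++⁺ˡ; ∈-++⁺ʳ; ∈-++⁻; ∈-filter⁺; ∈-map⁺; ∈-map⁻)
open import Data.List.Membership.Propositional.Properties.WithK using (unique∧set⇒bag)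
open import Data.List.Properties
  using (length-++; length-map; ∷-injectiveʳ; ++-cancelˡ; filter-accept; filter-reject; filter-all; filter-none)
open import Data.List.Relation.Binary.BagAndSetEquality using (∼bag⇒↭)
open import Data.List.Relation.Binary.Permutation.Propositional.Properties using (↭-length)
open import Data.List.Relation.Unary.All as All using (All; []; _∷_)
import Data.List.Relation.Unary.All.Properties as All
open import Data.List.Relation.Unary.AllPairs as AllPairs using (AllPairs; []; _∷_)
open import Data.List.Relation.Unary.Any using (here; there)
open import Data.List.Relation.Unary.Sorted.TotalOrder.Properties using (AllPairs⇒Sorted; Sorted⇒AllPairs)
open import Data.List.Relation.Unary.Unique.Propositional using (Unique)
import Data.List.Relation.Unary.Unique.Propositional.Properties as Unique
open import Data.Nat.Base using (ℕ; zero; suc; _+_; _*_; _∸_; _≤_; _<_; z≤n; s≤s; NonZero; parity)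
open import Data.Nat.ListAction using (sum)
open import Data.Nat.Properties
open import Data.Nat.Tactic.RingSolver using () renaming (solve-∀ to solve-ℕ)
open import Data.Parity.Base using (Parity; 0ℙ; 1ℙ; _⁻¹)
open import Data.Parity.Properties using (⁻¹-involutive)
open import Data.Product.Base using (∃; _×_; _,_; proj₁; proj₂)
open import Data.Sum.Base as Sum using (_⊎_; inj₁; inj₂)
open import Function.Base using (_∘_; id)
open import Function.Bundles using (_⇔_; mk⇔; Equivalence)
open import Relation.Binary.PropositionalEquality
open import Relation.Nullary using (¬_; contradiction; yes; no)

-- Shifted sequences

-- Multiplication by q^j, with d in the vacated places: d = 0 for power series, d = [] for
-- families of lists.
shift : {A : Set} → A → ℕ → (ℕ → A) → ℕ → A
shift d zero    f n       = f n
shift d (suc j) f zero    = d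
shift d (suc j) f (suc n) = shift d j f n

shift-map : ∀ {A B : Set} (h : A → B) {d : A} j {f : ℕ → A} n →
            h (shift d j f n) ≡ shift (h d) j (h ∘ f) n
shift-map h zero    n       = refl
shift-map h (suc j) zero    = refl
shift-map h (suc j) (suc n) = shift-map h j n

-- For addition and subtraction with both defaults `0ℤ`, the combined default computes to `0ℤ`
-- again, so this gives additivity of multiplication by q^j.
shift-zip : ∀ {A B C : Set} (_∙_ : A → B → C) {d : A} {e : B} j {f : ℕ → A} {g : ℕ → B} n →
            shift (d ∙ e) j (λ m → f m ∙ g m) n ≡ shift d j f n ∙ shift e j g n
shift-zip _∙_ zero    n       = refl
shift-zip _∙_ (suc j) zero    = refl
shift-zip _∙_ (suc j) (suc n) = shift-zip _∙_ j n

-- Agreement is asked only at the index that the shift reads, so induction hypotheses valid in a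
-- limited range of degrees can be applied under a shift.
shift-cong : ∀ {A : Set} {d : A} j {f g : ℕ → A} n → (∀ m → n ≡ j + m → f m ≡ g m) →
             shift d j f n ≡ shift d j g n
shift-cong zero    n       f≈g = f≈g n refl
shift-cong (suc j) zero    f≈g = refl
shift-cong (suc j) (suc n) f≈g = shift-cong j n (λ m → f≈g m ∘ cong suc)

shift-shift : ∀ {A : Set} {d : A} i j {f : ℕ → A} n →
              shift d i (shift d j f) n ≡ shift d (i + j) f n
shift-shift zero    j n       = refl
shift-shift (suc i) j zero    = refl
shift-shift (suc i) j (suc n) = shift-shift i j n

shift-below : ∀ {A : Set} {d : A} {j f n} → n < j → shift d j f n ≡ d
shift-below {j = suc j} {n = zero}  _         = refl
shift-below {j = suc j} {n = suc n} (s≤s n<j) = shift-below n<j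

-- Integer power series and finite q-products

Series : Set
Series = ℕ → ℤ

infixr 8 q^_·_

q^_·_ : ℕ → Series → Series
q^ j · f = shift 0ℤ j f

q^-cong : ∀ j {f g : Series} → (∀ m → f m ≡ g m) → ∀ n → (q^ j · f) n ≡ (q^ j · g) n
q^-cong j f≈g n = shift-cong j n (λ m _ → f≈g m)

q^-exponent : ∀ {i j} f n → i ≡ j → (q^ i · f) n ≡ (q^ j · f) n
q^-exponent f n i≡j = cong (λ e → (q^ e · f) n) i≡j

one : Series
one zero    = 1ℤ
one (suc _) = 0ℤ

-- ∏_{i=s+1}^{s+f} (1 − qⁱ)
qProduct : ℕ → ℕ → Series
qProduct s zero    n = one n
qProduct s (suc f) n = qProduct (suc s) f n - (q^ suc s · qProduct (suc s) f) n

q^-qProduct : ∀ j s f n → (q^ j · qProduct s (suc f)) n ≡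
              (q^ j · qProduct (suc s) f) n - (q^ j + suc s · qProduct (suc s) f) n
q^-qProduct j s f n =
  trans (shift-zip _-_ j n) (cong ((q^ j · qProduct (suc s) f) n -_) (shift-shift j (suc s) n))

interchange : ∀ a b c d → (a - b) - (c - d) ≡ (a - c) - (b - d)
interchange = solve-ℤ

-- The definition splits off the smallest factor; this splits off the largest. Inductively,
-- expanding (1 - q^s′)(1 - q^t) in either order gives the same four terms.
qProduct-last : ∀ s f n →
                qProduct s (suc f) n ≡ qProduct s f n - (q^ suc (s + f) · qProduct s f) n
qProduct-last s zero n = cong (λ e → one n - (q^ suc e · one) n) (sym (+-identityʳ s))
qProduct-last s (suc f) n = begin
  qProduct s′ (suc f) n - (q^ s′ · qProduct s′ (suc f)) n
    ≡⟨ cong₂ _-_ (qProduct-last s′ f n) shifted ⟩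
  (p n - (q^ t · p) n) - ((q^ s′ · p) n - (q^ s′ + t · p) n)
    ≡⟨ interchange (p n) ((q^ t · p) n) ((q^ s′ · p) n) ((q^ s′ + t · p) n) ⟩
  (p n - (q^ s′ · p) n) - ((q^ t · p) n - (q^ s′ + t · p) n)
    ≡⟨ cong (λ x → qProduct s (suc f) n - ((q^ t · p) n - x)) (q^-exponent p n (+-comm s′ t)) ⟩
  (p n - (q^ s′ · p) n) - ((q^ t · p) n - (q^ t + s′ · p) n)
    ≡⟨ cong (qProduct s (suc f) n -_) (q^-qProduct t s f n) ⟨
  qProduct s (suc f) n - (q^ t · qProduct s (suc f)) n
    ≡⟨ cong (qProduct s (suc f) n -_) (q^-exponent (qProduct s (suc f)) n (cong suc (sym (+-suc s f)))) ⟩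
  qProduct s (suc f) n - (q^ suc (s + suc f) · qProduct s (suc f)) n
    ∎
  where
  open ≡-Reasoning
  s′ = suc s
  t  = suc (s′ + f)
  p  = qProduct s′ f
  shifted : (q^ s′ · qProduct s′ (suc f)) n ≡ (q^ s′ · p) n - (q^ s′ + t · p) n
  shifted = trans (q^-cong s′ (qProduct-last s′ f) n)
           (trans (shift-zip _-_ s′ n) (cong ((q^ s′ · p) n -_) (shift-shift s′ t n)))

q^-qProduct-last : ∀ j s f n → (q^ j · qProduct s (suc f)) n ≡
                   (q^ j · qProduct s f) n - (q^ j + suc (s + f) · qProduct s f) n
q^-qProduct-last j s f n =
  trans (q^-cong j (qProduct-last s f) n)
 (trans (shift-zip _-_ j n) (cong ((q^ j · qProduct s f) n -_) (shift-shift j (suc (s + f)) n)))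

triangle : ℕ → ℕ
triangle zero    = 0
triangle (suc n) = suc n + triangle n

one-positive : ∀ {n} → 1 ≤ n → one n ≡ 0ℤ
one-positive (s≤s _) = refl

-- The degree is 1 + ... + f. After the largest factor is split off, the shift lowers the index by
-- `suc f`, exactly the amount by which the triangular number drops.
qProduct-degree : ∀ f n → triangle f < n → qProduct 0 f n ≡ 0ℤ
qProduct-degree zero    n 0<n   = one-positive 0<n
qProduct-degree (suc f) n tri<n = trans (qProduct-last 0 f n) (cong₂ _-_
  (qProduct-degree f n (≤-<-trans (m≤n+m _ (suc f)) tri<n))
  (trans (shift-cong (suc f) n λ m n≡ → qProduct-degree f m
            (+-cancelˡ-< (suc f) _ _ (<-≤-trans tri<n (≤-reflexive n≡))))
         (shift-zero (suc f) n)))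
  where
  shift-zero : ∀ j n → (q^ j · (λ _ → 0ℤ)) n ≡ 0ℤ
  shift-zero j n = sym (shift-map {A = ℤ} (λ _ → 0ℤ) {0ℤ} j {λ _ → 0ℤ} n)

-- Σ t i j over i + j = s + f with i ≥ s
diagonal : ℕ → ℕ → (ℕ → ℕ → ℤ) → ℤ
diagonal s zero    t = t s 0
diagonal s (suc f) t = t s (suc f) ℤ.+ diagonal (suc s) f t

diagonal-zero : ∀ s f {t} → (∀ i j → s ≤ i → i + j ≡ s + f → t i j ≡ 0ℤ) → diagonal s f t ≡ 0ℤ
diagonal-zero s zero    t≡0 = t≡0 s 0 ≤-refl refl
diagonal-zero s (suc f) t≡0 = cong₂ ℤ._+_ (t≡0 s (suc f) ≤-refl refl)
  (diagonal-zero (suc s) f λ i j s<i i+j≡ → t≡0 i j (<⇒≤ s<i) (trans i+j≡ (sym (+-suc s f))))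

-- Shanks' finite pentagonal number theorem

shanksTerm : ℕ → ℕ → ℕ → ℕ → ℤ
shanksTerm n N s f = -1ℤ ^ s ℤ.* (q^ s * n + triangle s · qProduct s f) N

shanksSum : ℕ → ℕ → ℤ
shanksSum n N = diagonal 0 n (shanksTerm n N)

-- These are j(3j + 1)/2 and j(3j - 1)/2, written without division; both are 0 at j = 0.
pent⁺ pent⁻ : ℕ → ℕ
pent⁺ j = j * j + triangle j
pent⁻ j = j * j + triangle (j ∸ 1)

pentagonalPair : ℕ → ℕ → ℤ
pentagonalPair j N = -1ℤ ^ j ℤ.* ((q^ pent⁺ j · one) N ℤ.+ (q^ pent⁻ j · one) N)

-- The two exponents coincide at j = 0, so that index contributes a single 1 instead of a pair.
pentagonalSum : ℕ → ℕ → ℤ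
pentagonalSum zero    N = one N
pentagonalSum (suc n) N = pentagonalSum n N ℤ.+ pentagonalPair (suc n) N

-- The terms of shanksSum (suc n) − shanksSum n telescope; the last summand below is minus the
-- contribution of the terms with index < s.
shanks-telescope : ∀ n N s f → s + f ≡ n →
  diagonal s (suc f) (shanksTerm (suc n) N) ≡
  diagonal s f (shanksTerm n N) ℤ.+ pentagonalPair (suc n) N ℤ.+
  -1ℤ ^ s ℤ.* ((q^ s * suc n + triangle s · qProduct s f) N - (q^ s * n + triangle s · qProduct s f) N)
-- Here s = n. The factor 1 - q^(s+1) of the leading term produces exponent `pent⁻ (suc s)`, and the
-- new term of index s + 1 has exponent `pent⁺ (suc s)`.
shanks-telescope n N s zero s+0≡n
  with refl ← trans (sym (+-identityʳ s)) s+0≡n = begin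
  σ ℤ.* (q^ e · qProduct s 1) N ℤ.+ -1ℤ ℤ.* σ ℤ.* p⁺
    ≡⟨ cong (λ x → σ ℤ.* x ℤ.+ -1ℤ ℤ.* σ ℤ.* p⁺) first ⟩
  σ ℤ.* (x - p⁻) ℤ.+ -1ℤ ℤ.* σ ℤ.* p⁺
    ≡⟨ ring σ x p⁻ p⁺ y ⟩
  σ ℤ.* y ℤ.+ -1ℤ ℤ.* σ ℤ.* (p⁺ ℤ.+ p⁻) ℤ.+ σ ℤ.* (x - y)
    ∎
  where
  open ≡-Reasoning
  σ  = -1ℤ ^ s
  e  = s * suc s + triangle s
  x  = (q^ e · one) N
  y  = (q^ s * s + triangle s · one) N
  p⁺ = (q^ pent⁺ (suc s) · one) N
  p⁻ = (q^ pent⁻ (suc s) · one) N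
  ring : ∀ σ x p⁻ p⁺ y → σ ℤ.* (x - p⁻) ℤ.+ -1ℤ ℤ.* σ ℤ.* p⁺ ≡
                         σ ℤ.* y ℤ.+ -1ℤ ℤ.* σ ℤ.* (p⁺ ℤ.+ p⁻) ℤ.+ σ ℤ.* (x - y)
  ring = solve-ℤ
  exponent : ∀ s t → (s * suc s + t) + suc s ≡ suc s * suc s + t
  exponent = solve-ℕ
  first : (q^ e · qProduct s 1) N ≡ x - p⁻
  first = trans (q^-qProduct e s 0 N) (cong (x -_) (q^-exponent one N (exponent s (triangle s))))
-- Splitting the factor 1 - q^(n+1) off the leading term, and then 1 - q^(s+1) off what is
-- subtracted, gives `a - (b - c)`. The remainder of the tail is `c - b` with the opposite sign, so
-- only `a` survives.
shanks-telescope n N s (suc f) s+f≡n = begin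
  σ ℤ.* (q^ A · qProduct s (suc (suc f))) N ℤ.+ diagonal (suc s) (suc f) (shanksTerm (suc n) N)
    ≡⟨ cong₂ (λ u v → σ ℤ.* u ℤ.+ v) top
         (shanks-telescope n N (suc s) f (trans (sym (+-suc s f)) s+f≡n)) ⟩
  σ ℤ.* (a - (b - c)) ℤ.+ (rest ℤ.+ pair ℤ.+ -1ℤ ℤ.* σ ℤ.* (c - (q^ B′ · r) N))
    ≡⟨ cong (λ u → σ ℤ.* (a - (b - c)) ℤ.+ (rest ℤ.+ pair ℤ.+ -1ℤ ℤ.* σ ℤ.* (c - u)))
         (q^-exponent r N (exponent₁ s n (triangle s))) ⟩
  σ ℤ.* (a - (b - c)) ℤ.+ (rest ℤ.+ pair ℤ.+ -1ℤ ℤ.* σ ℤ.* (c - b))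
    ≡⟨ ring σ a b c rest pair d ⟩
  σ ℤ.* d ℤ.+ rest ℤ.+ pair ℤ.+ σ ℤ.* (a - d)
    ∎
  where
  open ≡-Reasoning
  σ = -1ℤ ^ s
  p = qProduct s (suc f)
  r = qProduct (suc s) f
  A = s * suc n + triangle s
  B = A + suc n
  B′ = suc s * n + triangle (suc s)
  a = (q^ A · p) N
  b = (q^ B · r) N
  c = (q^ suc s * suc n + triangle (suc s) · r) N
  d = (q^ s * n + triangle s · p) N
  rest = diagonal (suc s) f (shanksTerm n N)
  pair = pentagonalPair (suc n) N
  ring : ∀ σ a b c rest pair d →
    σ ℤ.* (a - (b - c)) ℤ.+ (rest ℤ.+ pair ℤ.+ -1ℤ ℤ.* σ ℤ.* (c - b)) ≡
    σ ℤ.* d ℤ.+ rest ℤ.+ pair ℤ.+ σ ℤ.* (a - d)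
  ring = solve-ℤ
  exponent₁ : ∀ s n t → suc s * n + (suc s + t) ≡ s * suc n + t + suc n
  exponent₁ = solve-ℕ
  exponent₂ : ∀ s n t → s * suc n + t + suc n + suc s ≡ suc s * suc n + (suc s + t)
  exponent₂ = solve-ℕ
  top : (q^ A · qProduct s (suc (suc f))) N ≡ a - (b - c)
  top = begin
    (q^ A · qProduct s (suc (suc f))) N
      ≡⟨ q^-qProduct-last A s (suc f) N ⟩
    a - (q^ A + suc (s + suc f) · p) N
      ≡⟨ cong (λ m → a - (q^ A + suc m · p) N) s+f≡n ⟩
    a - (q^ B · p) N
      ≡⟨ cong (a -_) (q^-qProduct B s f N) ⟩
    a - (b - (q^ B + suc s · r) N)
      ≡⟨ cong (λ u → a - (b - u)) (q^-exponent r N (exponent₂ s n (triangle s))) ⟩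
    a - (b - c)
      ∎

shanks : ∀ n N → shanksSum n N ≡ pentagonalSum n N
shanks zero    N = ℤ.*-identityˡ (one N)
shanks (suc n) N = begin
  shanksSum (suc n) N
    -- At s = 0 both exponents in the remainder compute to 0, so it has the form `p - p`.
    ≡⟨ shanks-telescope n N 0 n refl ⟩
  shanksSum n N ℤ.+ pentagonalPair (suc n) N ℤ.+ 1ℤ ℤ.* (p - p)
    ≡⟨ ring (shanksSum n N) (pentagonalPair (suc n) N) p ⟩
  shanksSum n N ℤ.+ pentagonalPair (suc n) N
    ≡⟨ cong (ℤ._+ pentagonalPair (suc n) N) (shanks n N) ⟩
  pentagonalSum (suc n) N
    ∎
  where
  open ≡-Reasoning
  p = qProduct 0 n N
  ring : ∀ a b p → a ℤ.+ b ℤ.+ 1ℤ ℤ.* (p - p) ≡ a ℤ.+ b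
  ring = solve-ℤ

qProduct-pentagonal : ∀ {M N} → N ≤ M → qProduct 0 M N ≡ pentagonalSum M N
qProduct-pentagonal {zero}  {N} _   = refl
qProduct-pentagonal {suc M} {N} N≤M = begin
  qProduct 0 (suc M) N
    ≡⟨ ring (qProduct 0 (suc M) N) ⟩
  1ℤ ℤ.* qProduct 0 (suc M) N ℤ.+ 0ℤ
    ≡⟨ cong (ℤ._+_ (1ℤ ℤ.* qProduct 0 (suc M) N)) (diagonal-zero 1 M vanish) ⟨
  shanksSum (suc M) N
    ≡⟨ shanks (suc M) N ⟩
  pentagonalSum (suc M) N
    ∎
  where
  open ≡-Reasoning
  ring : ∀ a → a ≡ 1ℤ ℤ.* a ℤ.+ 0ℤ
  ring = solve-ℤ
  -- For i ≥ 1 the exponent is at least (M + 1) + 1, the triangular part being at least 1; it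
  -- exceeds N even when N = M + 1.
  vanish : ∀ i j → 1 ≤ i → i + j ≡ suc M → shanksTerm (suc M) N i j ≡ 0ℤ
  vanish (suc i) j _ _ = trans
    (cong (-1ℤ ^ suc i ℤ.*_) (shift-below {f = qProduct (suc i) j}
      (≤-trans (≤-trans (s≤s N≤M) (≤-reflexive (+-comm 1 (suc M))))
               (+-mono-≤ (m≤m+n (suc M) (i * suc M)) (s≤s z≤n)))))
    (ℤ.*-zeroʳ (-1ℤ ^ suc i))

-- Generalized pentagonal numbers

q^-one-≡ : ∀ n → (q^ n · one) n ≡ 1ℤ
q^-one-≡ zero    = refl
q^-one-≡ (suc n) = q^-one-≡ n

q^-one-≢ : ∀ j {n} → n ≢ j → (q^ j · one) n ≡ 0ℤ
q^-one-≢ zero    {zero}  n≢j = contradiction refl n≢j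
q^-one-≢ zero    {suc n} n≢j = refl
q^-one-≢ (suc j) {zero}  n≢j = refl
q^-one-≢ (suc j) {suc n} n≢j = q^-one-≢ j (n≢j ∘ cong suc)

IsPent : ℕ → ℕ → Set
IsPent N j = N ≡ pent⁺ j ⊎ N ≡ pent⁻ j

pent⁻<pent⁺ : ∀ j → pent⁻ (suc j) < pent⁺ (suc j)
pent⁻<pent⁺ j = +-monoʳ-< (suc j * suc j) (s≤s (m≤n+m (triangle j) j))

triangle-mono : ∀ {i j} → i ≤ j → triangle i ≤ triangle j
triangle-mono z≤n       = z≤n
triangle-mono (s≤s i≤j) = +-mono-≤ (s≤s i≤j) (triangle-mono i≤j)

-- The squares grow strictly, and the triangular parts weakly because i ≤ j - 1. Hence the intervals
-- from `pent⁻ j` to `pent⁺ j` are disjoint, which makes the index of a pentagonal number unique.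
pent⁺<pent⁻ : ∀ {i j} → i < j → pent⁺ i < pent⁻ j
pent⁺<pent⁻ {i} {suc j} (s≤s i≤j) =
  +-mono-<-≤ (*-mono-< (s≤s i≤j) (s≤s i≤j)) (triangle-mono i≤j)

IsPent⇒≤pent⁺ : ∀ {N} j → IsPent N j → N ≤ pent⁺ j
IsPent⇒≤pent⁺ j       (inj₁ refl) = ≤-refl
IsPent⇒≤pent⁺ zero    (inj₂ refl) = z≤n
IsPent⇒≤pent⁺ (suc j) (inj₂ refl) = <⇒≤ (pent⁻<pent⁺ j)

IsPent⇒pent⁻≤ : ∀ {N} j → IsPent N j → pent⁻ j ≤ N
IsPent⇒pent⁻≤ zero    _           = z≤n
IsPent⇒pent⁻≤ (suc j) (inj₁ refl) = <⇒≤ (pent⁻<pent⁺ j)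
IsPent⇒pent⁻≤ (suc j) (inj₂ refl) = ≤-refl

-- Places the index of a pentagonal number N ≤ M within the range of `pentagonalSum M`.
IsPent⇒≤ : ∀ {N} j → IsPent N j → j ≤ N
IsPent⇒≤ zero    _ = z≤n
IsPent⇒≤ (suc j) p = ≤-trans (≤-trans (m≤m*n (suc j) (suc j)) (m≤m+n _ (triangle j)))
                             (IsPent⇒pent⁻≤ (suc j) p)

IsPent-unique-< : ∀ {N i j} → i < j → IsPent N i → ¬ IsPent N j
IsPent-unique-< {i = i} {j} i<j p q =
  <⇒≱ (pent⁺<pent⁻ i<j) (≤-trans (IsPent⇒pent⁻≤ j q) (IsPent⇒≤pent⁺ i p))

pentagonalPair-≡ : ∀ {N} j → IsPent N (suc j) → pentagonalPair (suc j) N ≡ -1ℤ ^ suc j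
pentagonalPair-≡ j p = trans (cong (-1ℤ ^ suc j ℤ.*_) (one-pent p)) (ℤ.*-identityʳ _)
  where
  one-pent : ∀ {N} → IsPent N (suc j) →
             (q^ pent⁺ (suc j) · one) N ℤ.+ (q^ pent⁻ (suc j) · one) N ≡ 1ℤ
  one-pent (inj₁ refl) = cong₂ ℤ._+_ (q^-one-≡ (pent⁺ (suc j))) (q^-one-≢ (pent⁻ (suc j)) (>⇒≢ (pent⁻<pent⁺ j)))
  one-pent (inj₂ refl) = cong₂ ℤ._+_ (q^-one-≢ (pent⁺ (suc j)) (<⇒≢ (pent⁻<pent⁺ j))) (q^-one-≡ (pent⁻ (suc j)))

pentagonalPair-≢ : ∀ {N} j → ¬ IsPent N j → pentagonalPair j N ≡ 0ℤ
pentagonalPair-≢ j ¬p = trans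
  (cong (-1ℤ ^ j ℤ.*_) (cong₂ ℤ._+_ (q^-one-≢ (pent⁺ j) (¬p ∘ inj₁)) (q^-one-≢ (pent⁻ j) (¬p ∘ inj₂))))
  (ℤ.*-zeroʳ (-1ℤ ^ j))

pentagonalSum-≢ : ∀ M {N} → 1 ≤ N → (∀ j → j ≤ M → ¬ IsPent N j) → pentagonalSum M N ≡ 0ℤ
pentagonalSum-≢ zero    1≤N ¬p = one-positive 1≤N
pentagonalSum-≢ (suc M) 1≤N ¬p = cong₂ ℤ._+_
  (pentagonalSum-≢ M 1≤N (λ j j≤M → ¬p j (m≤n⇒m≤1+n j≤M))) (pentagonalPair-≢ (suc M) (¬p (suc M) ≤-refl))

-- By uniqueness of the index a single summand survives: it lies in the shorter sum or is the last
-- pair.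
pentagonalSum-≡ : ∀ M {N j} → 1 ≤ N → j ≤ M → IsPent N j → pentagonalSum M N ≡ -1ℤ ^ j
pentagonalSum-≡ zero    {j = zero} 1≤N _ p = contradiction (IsPent⇒≤pent⁺ 0 p) (<⇒≱ 1≤N)
pentagonalSum-≡ (suc M) {N} {j} 1≤N j≤M p with m≤n⇒m<n∨m≡n j≤M
... | inj₁ (s≤s j≤M′) = trans
  (cong₂ ℤ._+_ (pentagonalSum-≡ M 1≤N j≤M′ p) (pentagonalPair-≢ (suc M) (IsPent-unique-< (s≤s j≤M′) p)))
  (ℤ.+-identityʳ _)
... | inj₂ refl = trans
  (cong₂ ℤ._+_ (pentagonalSum-≢ M 1≤N (λ i i≤M q → IsPent-unique-< (s≤s i≤M) q p)) (pentagonalPair-≡ M p))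
  (ℤ.+-identityˡ _)

double-triangle : ∀ n → 2 * triangle n ≡ suc n * n
double-triangle zero    = refl
double-triangle (suc n) = begin
  2 * (suc n + triangle n)       ≡⟨ *-distribˡ-+ 2 (suc n) (triangle n) ⟩
  2 * suc n + 2 * triangle n     ≡⟨ cong (λ t → 2 * suc n + t) (double-triangle n) ⟩
  2 * suc n + suc n * n          ≡⟨ ring n ⟩
  suc (suc n) * suc n            ∎
  where
  open ≡-Reasoning
  ring : ∀ n → 2 * suc n + suc n * n ≡ suc (suc n) * suc n
  ring = solve-ℕ

double-pent⁺ : ∀ j → + 2 ℤ.* + pent⁺ j ≡ + j ℤ.* (+ 3 ℤ.* + j ℤ.+ 1ℤ)
double-pent⁺ j = begin
  + 2 ℤ.* + pent⁺ j                 ≡⟨ ℤ.pos-* 2 (pent⁺ j) ⟨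
  + (2 * pent⁺ j)                   ≡⟨ cong +_ doubled ⟩
  + (j * (3 * j + 1))               ≡⟨ ℤ.pos-* j (3 * j + 1) ⟩
  + j ℤ.* (+ (3 * j) ℤ.+ 1ℤ)        ≡⟨ cong (λ x → + j ℤ.* (x ℤ.+ 1ℤ)) (ℤ.pos-* 3 j) ⟩
  + j ℤ.* (+ 3 ℤ.* + j ℤ.+ 1ℤ)      ∎
  where
  open ≡-Reasoning
  ring : ∀ j → 2 * (j * j) + suc j * j ≡ j * (3 * j + 1)
  ring = solve-ℕ
  doubled : 2 * pent⁺ j ≡ j * (3 * j + 1)
  doubled = trans (*-distribˡ-+ 2 (j * j) (triangle j))
           (trans (cong (λ t → 2 * (j * j) + t) (double-triangle j)) (ring j))

pent⁺≡pent⁻+ : ∀ j → pent⁺ j ≡ pent⁻ j + j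
pent⁺≡pent⁻+ zero    = refl
pent⁺≡pent⁻+ (suc j) = ring (suc j) (suc j * suc j) (triangle j)
  where
  ring : ∀ j s t → s + (j + t) ≡ s + t + j
  ring = solve-ℕ

-- Derived from `double-pent⁺` over the integers by subtracting 2j, which avoids calculating with
-- the truncated `j ∸ 1`.
double-pent⁻ : ∀ j → + 2 ℤ.* + pent⁻ j ≡ + j ℤ.* (+ 3 ℤ.* + j - 1ℤ)
double-pent⁻ j = begin
  + 2 ℤ.* + pent⁻ j                              ≡⟨ ring₁ (+ pent⁻ j) (+ j) ⟩
  + 2 ℤ.* (+ pent⁻ j ℤ.+ + j) - + 2 ℤ.* + j      ≡⟨ cong (λ p → + 2 ℤ.* + p - + 2 ℤ.* + j) (pent⁺≡pent⁻+ j) ⟨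
  + 2 ℤ.* + pent⁺ j - + 2 ℤ.* + j                ≡⟨ cong (_- + 2 ℤ.* + j) (double-pent⁺ j) ⟩
  + j ℤ.* (+ 3 ℤ.* + j ℤ.+ 1ℤ) - + 2 ℤ.* + j     ≡⟨ ring₂ (+ j) ⟩
  + j ℤ.* (+ 3 ℤ.* + j - 1ℤ)                     ∎
  where
  open ≡-Reasoning
  ring₁ : ∀ p j → + 2 ℤ.* p ≡ + 2 ℤ.* (p ℤ.+ j) - + 2 ℤ.* j
  ring₁ = solve-ℤ
  ring₂ : ∀ j → j ℤ.* (+ 3 ℤ.* j ℤ.+ 1ℤ) - + 2 ℤ.* j ≡ j ℤ.* (+ 3 ℤ.* j - 1ℤ)
  ring₂ = solve-ℤ

IsPent⇒Pentagonal : ∀ {N} j → IsPent N j → Pentagonal N (+ j)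
IsPent⇒Pentagonal j (inj₁ refl) = inj₁ (double-pent⁺ j)
IsPent⇒Pentagonal j (inj₂ refl) = inj₂ (double-pent⁻ j)

Pentagonal⇒IsPent : ∀ {N} m → Pentagonal N m → IsPent N ∣ m ∣
Pentagonal⇒IsPent {N} (+ j) =
  Sum.map (λ e → halve (trans e (sym (double-pent⁺ j)))) (λ e → halve (trans e (sym (double-pent⁻ j))))
  where
  halve : ∀ {p} → + 2 ℤ.* + N ≡ + 2 ℤ.* + p → N ≡ p
  halve = ℤ.+-injective ∘ ℤ.*-cancelˡ-≡ (+ 2) _ _
-- Negating m exchanges m(3m + 1) and m(3m - 1), hence the swap.
Pentagonal⇒IsPent {N} -[1+ j ] = Pentagonal⇒IsPent (+ suc j) ∘ Sum.swap ∘
  Sum.map (λ e → trans e (ring₁ (+ suc j))) (λ e → trans e (ring₂ (+ suc j)))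
  where
  ring₁ : ∀ x → ℤ.- x ℤ.* (+ 3 ℤ.* ℤ.- x ℤ.+ 1ℤ) ≡ x ℤ.* (+ 3 ℤ.* x - 1ℤ)
  ring₁ = solve-ℤ
  ring₂ : ∀ x → ℤ.- x ℤ.* (+ 3 ℤ.* ℤ.- x - 1ℤ) ≡ x ℤ.* (+ 3 ℤ.* x ℤ.+ 1ℤ)
  ring₂ = solve-ℤ

-- The series Σₛ q^{ks} ∏_{j>s} (1 − q^j)

-- Σ_{i=s}^{s+f} q^{ki} ∏_{j=i+1}^{s+f} (1 − q^j)
smallestSum : ℕ → ℕ → ℕ → Series
smallestSum k s f n = diagonal s f (λ i j → (q^ k * i · qProduct i j) n)

-- Telescopes: q^i times the product over j > i is the product over j > i minus the product over j ≥
-- i.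
smallestSum-once : ∀ s f n → smallestSum 1 (suc s) f n ≡ one n - qProduct s (suc f) n
smallestSum-once s zero n = trans (q^-exponent one n (*-identityˡ (suc s))) (ring (one n) ((q^ suc s · one) n))
  where
  ring : ∀ a b → b ≡ a - (a - b)
  ring = solve-ℤ
smallestSum-once s (suc f) n = trans
  (cong₂ ℤ._+_ (q^-exponent (qProduct (suc s) (suc f)) n (*-identityˡ (suc s))) (smallestSum-once (suc s) f n))
  (ring (one n) (qProduct (suc s) (suc f) n) ((q^ suc s · qProduct (suc s) (suc f)) n))
  where
  ring : ∀ a p b → b ℤ.+ (a - p) ≡ a - (p - b)
  ring = solve-ℤ

-- The factor 1 - q^(s+1) turns q^(k + ks) into q^(k(s+1)) - q^((k+1)(s+1)), the powers in the terms
-- of index s + 1 for k and k + 1.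
reindex : ∀ k s f n → (q^ k · q^ k * s · qProduct s (suc f)) n ≡
          (q^ k * suc s · qProduct (suc s) f) n - (q^ suc k * suc s · qProduct (suc s) f) n
reindex k s f n = begin
  (q^ k · q^ k * s · qProduct s (suc f)) n
    ≡⟨ shift-shift k (k * s) n ⟩
  (q^ k + k * s · qProduct s (suc f)) n
    ≡⟨ q^-qProduct (k + k * s) s f n ⟩
  (q^ k + k * s · p) n - (q^ k + k * s + suc s · p) n
    ≡⟨ cong₂ _-_ (q^-exponent p n (exponent₁ k s)) (q^-exponent p n (exponent₂ k s)) ⟩
  (q^ k * suc s · p) n - (q^ suc k * suc s · p) n
    ∎
  where
  open ≡-Reasoning
  p = qProduct (suc s) f
  exponent₁ : ∀ k s → k + k * s ≡ k * suc s
  exponent₁ = solve-ℕ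
  exponent₂ : ∀ k s → k + k * s + suc s ≡ suc k * suc s
  exponent₂ = solve-ℕ

-- q^{ki}(1 − qⁱ) ∏_{j>i} (1 − q^j) = q^k · q^{k(i−1)} ∏_{j≥i} (1 − q^j), so the sums for k and k + 1
-- differ by a reindexed copy of the sum for k, up to its last term.
smallestSum-suc-positive : ∀ k s f n →
  smallestSum k (suc s) f n ℤ.+ (q^ k · q^ k * (suc s + f) · one) n ≡
  smallestSum (suc k) (suc s) f n ℤ.+ (q^ k · smallestSum k s (suc f)) n
smallestSum-suc-positive k s zero n = begin
  a ℤ.+ (q^ k · q^ k * (suc s + 0) · one) n
    ≡⟨ cong (λ e → a ℤ.+ (q^ k · q^ k * e · one) n) (+-identityʳ (suc s)) ⟩
  a ℤ.+ b
    ≡⟨ ring a b c ⟩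
  c ℤ.+ ((a - c) ℤ.+ b)
    ≡⟨ cong (λ x → c ℤ.+ (x ℤ.+ b)) (reindex k s 0 n) ⟨
  c ℤ.+ ((q^ k · q^ k * s · qProduct s 1) n ℤ.+ b)
    ≡⟨ cong (λ x → c ℤ.+ x) (shift-zip ℤ._+_ k n) ⟨
  c ℤ.+ (q^ k · smallestSum k s 1) n
    ∎
  where
  open ≡-Reasoning
  a = (q^ k * suc s · one) n
  b = (q^ k · q^ k * suc s · one) n
  c = (q^ suc k * suc s · one) n
  ring : ∀ a b c → a ℤ.+ b ≡ c ℤ.+ ((a - c) ℤ.+ b)
  ring = solve-ℤ
smallestSum-suc-positive k s (suc f) n = begin
  a ℤ.+ A ℤ.+ (q^ k · q^ k * (suc s + suc f) · one) n
    ≡⟨ cong (λ e → a ℤ.+ A ℤ.+ (q^ k · q^ k * e · one) n) (+-suc (suc s) f) ⟩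
  a ℤ.+ A ℤ.+ b
    ≡⟨ ℤ.+-assoc a A b ⟩
  a ℤ.+ (A ℤ.+ b)
    ≡⟨ cong (λ x → a ℤ.+ x) (smallestSum-suc-positive k (suc s) f n) ⟩
  a ℤ.+ (C ℤ.+ d)
    ≡⟨ ring a C d c ⟩
  c ℤ.+ C ℤ.+ ((a - c) ℤ.+ d)
    ≡⟨ cong (λ x → c ℤ.+ C ℤ.+ (x ℤ.+ d)) (reindex k s (suc f) n) ⟨
  c ℤ.+ C ℤ.+ ((q^ k · q^ k * s · qProduct s (suc (suc f))) n ℤ.+ d)
    ≡⟨ cong (λ x → c ℤ.+ C ℤ.+ x) (shift-zip ℤ._+_ k n) ⟨
  c ℤ.+ C ℤ.+ (q^ k · smallestSum k s (suc (suc f))) n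
    ∎
  where
  open ≡-Reasoning
  p = qProduct (suc s) (suc f)
  a = (q^ k * suc s · p) n
  A = smallestSum k (suc (suc s)) f n
  b = (q^ k · q^ k * (suc (suc s) + f) · one) n
  c = (q^ suc k * suc s · p) n
  C = smallestSum (suc k) (suc (suc s)) f n
  d = (q^ k · smallestSum k (suc s) (suc f)) n
  ring : ∀ a C d c → a ℤ.+ (C ℤ.+ d) ≡ c ℤ.+ C ℤ.+ ((a - c) ℤ.+ d)
  ring = solve-ℤ

-- The recurrence survives truncation in degrees n ≤ M: the terms of index 0 have exponent 0 in both
-- sums and agree, and the leftover last term has exponent above n.
smallestSum-suc : ∀ k M n → n ≤ M →
  smallestSum (suc (suc k)) 0 (suc M) n ≡
  smallestSum (suc k) 0 (suc M) n - (q^ suc k · smallestSum (suc k) 0 (suc M)) n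
smallestSum-suc k M n n≤M = begin
  z′ ℤ.+ S′
    ≡⟨ cong (ℤ._+ S′) (q^-exponent p n (trans (*-zeroʳ (2 + k)) (sym (*-zeroʳ k′)))) ⟩
  z ℤ.+ S′
    ≡⟨ ring z S′ d ⟩
  z ℤ.+ (S′ ℤ.+ d) - d
    ≡⟨ cong (λ x → z ℤ.+ x - d) (smallestSum-suc-positive k′ 0 M n) ⟨
  z ℤ.+ (S ℤ.+ (q^ k′ · q^ k′ * suc M · one) n) - d
    ≡⟨ cong (λ x → z ℤ.+ (S ℤ.+ x) - d) junk ⟩
  z ℤ.+ (S ℤ.+ 0ℤ) - d
    ≡⟨ cong (λ x → z ℤ.+ x - d) (ℤ.+-identityʳ S) ⟩
  z ℤ.+ S - d
    ∎
  where
  open ≡-Reasoning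
  k′ = suc k
  p = qProduct 0 (suc M)
  z = (q^ k′ * 0 · p) n
  z′ = (q^ suc k′ * 0 · p) n
  S = smallestSum k′ 1 M n
  S′ = smallestSum (suc k′) 1 M n
  d = (q^ k′ · smallestSum k′ 0 (suc M)) n
  ring : ∀ z s d → z ℤ.+ s ≡ z ℤ.+ (s ℤ.+ d) - d
  ring = solve-ℤ
  junk : (q^ k′ · q^ k′ * suc M · one) n ≡ 0ℤ
  junk = trans (shift-shift k′ (k′ * suc M) n)
    (shift-below {f = one} (≤-trans (s≤s n≤M) (≤-trans (m≤m+n (suc M) (k * suc M)) (m≤n+m (k′ * suc M) k′))))

-- Both sides are 1 at k = 0 and gain a factor 1 - q^(k+1) at each step. A shift only lowers the
-- index, so the truncation bound is preserved.
smallestSum≡qProduct : ∀ k M n → n ≤ M → smallestSum (suc k) 0 (suc M) n ≡ qProduct 0 k n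
smallestSum≡qProduct zero M n _ = trans
  (cong (λ x → qProduct 0 (suc M) n ℤ.+ x) (smallestSum-once 0 M n)) (ring (qProduct 0 (suc M) n) (one n))
  where
  ring : ∀ p a → p ℤ.+ (a - p) ≡ a
  ring = solve-ℤ
smallestSum≡qProduct (suc k) M n n≤M = begin
  smallestSum (suc (suc k)) 0 (suc M) n
    ≡⟨ smallestSum-suc k M n n≤M ⟩
  smallestSum (suc k) 0 (suc M) n - (q^ suc k · smallestSum (suc k) 0 (suc M)) n
    ≡⟨ cong₂ _-_ (smallestSum≡qProduct k M n n≤M) (shift-cong (suc k) n λ m n≡ →
         smallestSum≡qProduct k M m (≤-trans (≤-trans (m≤n+m m (suc k)) (≤-reflexive (sym n≡))) n≤M)) ⟩
  qProduct 0 k n - (q^ suc k · qProduct 0 k) n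
    ≡⟨ qProduct-last 0 k n ⟨
  qProduct 0 (suc k) n
    ∎
  where open ≡-Reasoning

-- Explicit enumerations

-- Duplicate-free lists with the same members are permutations of each other. The counts can
-- therefore be computed on recursively built lists.
enumeration-size : ∀ {A : Set} {P Q : A → Set} (E : Enumeration P) (E′ : Enumeration Q) →
                   (∀ x → P x ⇔ Q x) → size E ≡ size E′
enumeration-size E E′ P⇔Q =
  ↭-length (∼bag⇒↭ (unique∧set⇒bag (unique E) (unique E′) λ {x} → mk⇔
    (from (exact E′ x) ∘ to (P⇔Q x) ∘ to (exact E x))
    (from (exact E x) ∘ from (P⇔Q x) ∘ to (exact E′ x))))
  where
  open Enumeration using (unique; exact)
  open Equivalence using (to; from)

module _ {A : Set} where

  ∈-shift⁺ : ∀ {x : A} j {f : ℕ → List A} {m} → x ∈ f m → x ∈ shift [] j f (j + m)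
  ∈-shift⁺ zero    x∈ = x∈
  ∈-shift⁺ (suc j) x∈ = ∈-shift⁺ j x∈

  ∈-shift⁻ : ∀ {x : A} j {f : ℕ → List A} n → x ∈ shift [] j f n → ∃ λ m → n ≡ j + m × x ∈ f m
  ∈-shift⁻ zero    n       x∈ = n , refl , x∈
  ∈-shift⁻ (suc j) (suc n) x∈ with m , n≡ , x∈f ← ∈-shift⁻ j n x∈ = m , cong suc n≡ , x∈f

  shift-unique : ∀ j {f : ℕ → List A} n → (∀ m → Unique (f m)) → Unique (shift [] j f n)
  shift-unique zero    n       f! = f! n
  shift-unique (suc j) zero    f! = []
  shift-unique (suc j) (suc n) f! = shift-unique j n f!

  signed : (Parity → List A) → ℤ
  signed L = + length (L 0ℙ) - + length (L 1ℙ)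

  signed-++ : ∀ (L K : Parity → List A) → signed (λ π → L π ++ K π) ≡ signed L ℤ.+ signed K
  signed-++ L K = begin
    + length (L 0ℙ ++ K 0ℙ) - + length (L 1ℙ ++ K 1ℙ)
      ≡⟨ cong₂ (λ a b → + a - + b) (length-++ (L 0ℙ)) (length-++ (L 1ℙ)) ⟩
    + (a + b) - + (c + d)
      ≡⟨ ring (+ a) (+ b) (+ c) (+ d) ⟩
    signed L ℤ.+ signed K
      ∎
    where
    open ≡-Reasoning
    a = length (L 0ℙ)
    b = length (K 0ℙ)
    c = length (L 1ℙ)
    d = length (K 1ℙ)
    ring : ∀ a b c d → (a ℤ.+ b) - (c ℤ.+ d) ≡ (a - c) ℤ.+ (b - d)
    ring = solve-ℤ

  -- Links the two uses of `shift`: delaying a family of lists by j multiplies its signed generating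
  -- function by q^j.
  signed-shift : ∀ j (L : Parity → ℕ → List A) n →
                 signed (λ π → shift [] j (L π) n) ≡ (q^ j · (λ m → signed (λ π → L π m))) n
  signed-shift zero    L n       = refl
  signed-shift (suc j) L zero    = refl
  signed-shift (suc j) L (suc n) = signed-shift j L n

signed-map : ∀ {A B : Set} (h : A → B) L → signed (map h ∘ L) ≡ signed L
signed-map h L = cong₂ (λ a b → + a - + b) (length-map h (L 0ℙ)) (length-map h (L 1ℙ))

-- Partitions into distinct parts from an interval

parity-suc : ∀ n → parity (suc n) ≡ parity n ⁻¹
parity-suc zero          = refl
parity-suc (suc zero)    = refl
parity-suc (suc (suc n)) = parity-suc n

emptyLists : Parity → ℕ → List (List ℕ)
emptyLists 0ℙ zero = [] ∷ []
emptyLists _  _    = []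

-- Follows the recursion of `qProduct`: the part s + 1 is either absent, or comes first, which flips
-- the parity and adds s + 1 to the total.
distinctLists : Parity → ℕ → ℕ → ℕ → List (List ℕ)
distinctLists π s zero    n = emptyLists π n
distinctLists π s (suc f) n =
  distinctLists π (suc s) f n ++ shift [] (suc s) (map (suc s ∷_) ∘ distinctLists (π ⁻¹) (suc s) f) n

distinctLists-signed : ∀ s f n → signed (λ π → distinctLists π s f n) ≡ qProduct s f n
distinctLists-signed s zero    zero    = refl
distinctLists-signed s zero    (suc n) = refl
distinctLists-signed s (suc f) n = begin
  signed (λ π → distinctLists π s (suc f) n)
    ≡⟨ signed-++ (λ π → L π n) (λ π → shift [] s′ (map (s′ ∷_) ∘ L (π ⁻¹)) n) ⟩
  signed (λ π → L π n) ℤ.+ signed (λ π → shift [] s′ (map (s′ ∷_) ∘ L (π ⁻¹)) n)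
    ≡⟨ cong₂ ℤ._+_ (distinctLists-signed s′ f n) (signed-shift s′ (λ π → map (s′ ∷_) ∘ L (π ⁻¹)) n) ⟩
  qProduct s′ f n ℤ.+ (q^ s′ · (λ m → signed (λ π → map (s′ ∷_) (L (π ⁻¹) m)))) n
    -- The parity flip exchanges the even and odd lists; this is the minus sign in 1 - q^(s+1).
    ≡⟨ cong (λ x → qProduct s′ f n ℤ.+ x) (q^-cong s′ negated n) ⟩
  qProduct s′ f n ℤ.+ (q^ s′ · (λ m → ℤ.- qProduct s′ f m)) n
    ≡⟨ cong (λ x → qProduct s′ f n ℤ.+ x) (shift-map ℤ.-_ s′ n) ⟨
  qProduct s (suc f) n
    ∎
  where
  open ≡-Reasoning
  s′ = suc s
  L : Parity → ℕ → List (List ℕ)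
  L π = distinctLists π s′ f
  negate : ∀ a b → b - a ≡ ℤ.- (a - b)
  negate = solve-ℤ
  negated : ∀ m → signed (λ π → map (s′ ∷_) (L (π ⁻¹) m)) ≡ ℤ.- qProduct s′ f m
  negated m = trans (signed-map (s′ ∷_) (λ π → L (π ⁻¹) m))
             (trans (negate (+ length (L 0ℙ m)) (+ length (L 1ℙ m))) (cong ℤ.-_ (distinctLists-signed s′ f m)))

record Distinct (π : Parity) (s f n : ℕ) (ps : List ℕ) : Set where
  constructor mkDistinct
  field
    increasing : AllPairs _<_ ps
    above      : All (s <_) ps
    below      : All (_≤ s + f) ps
    total      : sum ps ≡ n
    parity≡    : parity (length ps) ≡ π

distinctLists-sound : ∀ {π} s f {n ps} → ps ∈ distinctLists π s f n → Distinct π s f n ps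
distinctLists-sound {0ℙ} s zero {zero} (here refl) = mkDistinct [] [] [] refl refl
distinctLists-sound {π} s (suc f) {n} ps∈
  with ∈-++⁻ (distinctLists π (suc s) f n) ps∈
... | inj₁ p with mkDistinct inc gt le refl par ← distinctLists-sound {π} (suc s) f p =
  mkDistinct inc (All.map <⇒≤ gt) (All.map (λ {x} → subst (x ≤_) (sym (+-suc s f))) le) refl par
... | inj₂ p
  with m , refl , q ← ∈-shift⁻ (suc s) n p
  with qs , qs∈ , refl ← ∈-map⁻ (suc s ∷_) q
  with mkDistinct inc gt le refl par ← distinctLists-sound {π ⁻¹} (suc s) f qs∈ = mkDistinct
    (gt ∷ inc)
    (≤-refl ∷ All.map <⇒≤ gt)
    (≤-trans (s≤s (m≤m+n s f)) (≤-reflexive (sym (+-suc s f))) ∷ All.map (λ {x} → subst (x ≤_) (sym (+-suc s f))) le)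
    refl
    (trans (parity-suc (length qs)) (trans (cong _⁻¹ par) (⁻¹-involutive π)))

distinctLists-complete : ∀ {π} s f {n ps} → Distinct π s f n ps → ps ∈ distinctLists π s f n
distinctLists-complete s zero {ps = []} (mkDistinct _ _ _ refl refl) = here refl
distinctLists-complete s zero {ps = p ∷ ps} (mkDistinct _ (s<p ∷ _) (p≤s ∷ _) _ _) =
  contradiction (≤-trans p≤s (≤-reflexive (+-identityʳ s))) (<⇒≱ s<p)
distinctLists-complete {π} s (suc f) {ps = []} (mkDistinct _ _ _ refl refl) =
  ∈-++⁺ˡ (distinctLists-complete {π} (suc s) f (mkDistinct [] [] [] refl refl))
distinctLists-complete {π} s (suc f) {n} {p ∷ ps} (mkDistinct (p<ps ∷ inc) (s<p ∷ s<ps) le tot par)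
  with m≤n⇒m<n∨m≡n s<p
... | inj₁ s′<p = ∈-++⁺ˡ (distinctLists-complete {π} (suc s) f (mkDistinct
    (p<ps ∷ inc) (s′<p ∷ All.map (<-trans s′<p) p<ps)
    (All.map (λ {x} → subst (x ≤_) (+-suc s f)) le) tot par))
... | inj₂ refl with refl ← tot =
  ∈-++⁺ʳ (distinctLists π (suc s) f n)
    (∈-shift⁺ (suc s) (∈-map⁺ (suc s ∷_) (distinctLists-complete {π ⁻¹} (suc s) f (mkDistinct
      inc p<ps (All.map (λ {x} → subst (x ≤_) (+-suc s f)) (All.tail le)) refl
      (trans (sym (⁻¹-involutive _)) (cong _⁻¹ (trans (sym (parity-suc (length ps))) par)))))))

distinctLists-unique : ∀ π s f n → Unique (distinctLists π s f n)
distinctLists-unique 0ℙ s zero    zero    = [] ∷ []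
distinctLists-unique 0ℙ s zero    (suc n) = []
distinctLists-unique 1ℙ s zero    n       = []
distinctLists-unique π  s (suc f) n       = Unique.++⁺
  (distinctLists-unique π (suc s) f n)
  (shift-unique (suc s) n λ m → Unique.map⁺ ∷-injectiveʳ (distinctLists-unique (π ⁻¹) (suc s) f m))
  disjoint
  where
  -- Lists of the second kind start with s + 1, whereas all parts in the first kind exceed it.
  disjoint : ∀ {ps} → ps ∈ distinctLists π (suc s) f n ×
             ps ∈ shift [] (suc s) (map (suc s ∷_) ∘ distinctLists (π ⁻¹) (suc s) f) n → ⊥
  disjoint (p , q)
    with _ , _ , r ← ∈-shift⁻ (suc s) n q
    with _ , _ , refl ← ∈-map⁻ (suc s ∷_) r =
    <-irrefl refl (All.head (Distinct.above (distinctLists-sound (suc s) f p)))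

increasing⇒Unique : ∀ {ps} → AllPairs _<_ ps → Unique ps
increasing⇒Unique = AllPairs.map <⇒≢

increasing⇒IsPartition : ∀ {n ps} → AllPairs _<_ ps → sum ps ≡ n → IsPartition n ps
increasing⇒IsPartition inc = isPartition (AllPairs⇒Sorted ≤-totalOrder (AllPairs.map <⇒≤ inc))

-- The interval bounds unfold to positivity and `_≤ k ∸ 1`; what remains is that weakly increasing
-- and distinct together mean strictly increasing.
Distinct⇔DistinctPartition : ∀ π k n ps → Distinct π 0 (k ∸ 1) n ps ⇔ DistinctPartition π k n ps
Distinct⇔DistinctPartition π k n ps = mk⇔
  (λ (mkDistinct inc gt le tot par) →
    distinctPartition (increasing⇒IsPartition inc tot) gt (increasing⇒Unique inc) le par)
  (λ (distinctPartition (isPartition sorted tot) gt uniq le par) →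
    mkDistinct (AllPairs.zipWith (λ (x≤y , x≢y) → ≤∧≢⇒< x≤y x≢y) (Sorted⇒AllPairs ≤-totalOrder sorted , uniq))
      gt le tot par)

distinctEnumeration : ∀ π s f n → Enumeration (Distinct π s f n)
distinctEnumeration π s f n = record
  { elements = distinctLists π s f n
  ; unique   = distinctLists-unique π s f n
  ; exact    = λ ps → mk⇔ (distinctLists-sound s f) (distinctLists-complete s f)
  }

Pₑ-Pₒ≡qProduct : ∀ k n → + Pₑ k n - + Pₒ k n ≡ qProduct 0 (k ∸ 1) n
Pₑ-Pₒ≡qProduct k n = trans (cong₂ (λ a b → + a - + b) (size-distinct 0ℙ) (size-distinct 1ℙ))
                           (distinctLists-signed 0 (k ∸ 1) n)
  where
  size-distinct : ∀ π → size (distinctPartitions π k n) ≡ length (distinctLists π 0 (k ∸ 1) n)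
  size-distinct π = sym (enumeration-size (distinctEnumeration π 0 (k ∸ 1) n) (distinctPartitions π k n)
                          (Distinct⇔DistinctPartition π k n))

-- Multiplicities and the block of smallest parts

occurrences-≡ : ∀ x ps → occurrences x (x ∷ ps) ≡ suc (occurrences x ps)
occurrences-≡ x ps = cong length (filter-accept (x ≟_) refl)

occurrences-≢ : ∀ {x y} ps → x ≢ y → occurrences x (y ∷ ps) ≡ occurrences x ps
occurrences-≢ {x} ps x≢y = cong length (filter-reject (x ≟_) x≢y)

occurrences-none : ∀ {x ps} → All (x ≢_) ps → occurrences x ps ≡ 0
occurrences-none {x} x∉ps = cong length (filter-none (x ≟_) x∉ps)

occurrences-∈ : ∀ {x ps} → x ∈ ps → 1 ≤ occurrences x ps
occurrences-∈ {x} {ps} x∈ps = helper (∈-filter⁺ (x ≟_) x∈ps refl)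
  where
  helper : ∀ {qs} → x ∈ qs → 1 ≤ length qs
  helper (here _)  = s≤s z≤n
  helper (there _) = s≤s z≤n

Unique⇒occurrences≤1 : ∀ x {ps} → Unique ps → occurrences x ps ≤ 1
Unique⇒occurrences≤1 x []                 = z≤n
Unique⇒occurrences≤1 x {p ∷ ps} (p∉ps ∷ u) with x ≟ p
... | yes refl = ≤-reflexive (trans (occurrences-≡ x ps) (cong suc (occurrences-none p∉ps)))
... | no x≢p   = ≤-trans (≤-reflexive (occurrences-≢ ps x≢p)) (Unique⇒occurrences≤1 x u)

occurrences≤1⇒Unique : ∀ {ps} → All (λ x → occurrences x ps ≤ 1) ps → Unique ps
occurrences≤1⇒Unique []                    = []
occurrences≤1⇒Unique {p ∷ ps} (p≤1 ∷ ps≤1) =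
  All.tabulate (λ { q∈ps refl → <⇒≱ (s≤s (occurrences-∈ q∈ps)) (subst (_≤ 1) (occurrences-≡ p ps) p≤1) }) ∷
  occurrences≤1⇒Unique (All.map (λ {x} → ≤-trans (cons-mono x)) ps≤1)
  where
  cons-mono : ∀ x → occurrences x ps ≤ occurrences x (p ∷ ps)
  cons-mono x with x ≟ p
  ... | yes refl = ≤-trans (n≤1+n _) (≤-reflexive (sym (occurrences-≡ x ps)))
  ... | no x≢p   = ≤-reflexive (sym (occurrences-≢ ps x≢p))

module Block {s : ℕ} {qs : List ℕ} (s<qs : All (s <_) qs) where

  block : ℕ → List ℕ
  block k = replicate k s ++ qs

  block-occurrences : ∀ k → occurrences s (block k) ≡ k
  block-occurrences zero    = occurrences-none (All.map <⇒≢ s<qs)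
  block-occurrences (suc k) = trans (occurrences-≡ s (block k)) (cong suc (block-occurrences k))

  block-occurrences-≢ : ∀ k {x} → x ≢ s → occurrences x (block k) ≡ occurrences x qs
  block-occurrences-≢ zero    x≢s = refl
  block-occurrences-≢ (suc k) x≢s = trans (occurrences-≢ (block k) x≢s) (block-occurrences-≢ k x≢s)

  block-numberAbove : ∀ k → numberAbove s (block k) ≡ length qs
  block-numberAbove zero    = cong length (filter-all (s <?_) s<qs)
  block-numberAbove (suc k) = trans (cong length (filter-reject (s <?_) (<-irrefl refl))) (block-numberAbove k)

  block-sum : ∀ k → sum (block k) ≡ k * s + sum qs
  block-sum zero    = refl
  block-sum (suc k) = trans (cong (λ t → s + t) (block-sum k)) (sym (+-assoc s (k * s) (sum qs)))

  block-smallest : ∀ k → All (s ≤_) (block k)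
  block-smallest zero    = All.map <⇒≤ s<qs
  block-smallest (suc k) = ≤-refl ∷ block-smallest k

  block-sorted : ∀ k → AllPairs _<_ qs → AllPairs _≤_ (block k)
  block-sorted zero    inc = AllPairs.map <⇒≤ inc
  block-sorted (suc k) inc = block-smallest k ∷ block-sorted k inc

  block-isDPartition : ∀ k → AllPairs _<_ qs → IsDPartition (suc k) (suc k * s + sum qs) s (block (suc k))
  block-isDPartition k inc = isDPartition
    (isPartition (AllPairs⇒Sorted ≤-totalOrder (block-sorted (suc k) inc)) (block-sum (suc k)))
    (here refl)
    (block-smallest (suc k))
    (block-occurrences (suc k))
    (All.tabulate λ {x} _ x≢s → ≤-trans (≤-reflexive (block-occurrences-≢ (suc k) x≢s))
                                        (Unique⇒occurrences≤1 x (increasing⇒Unique inc)))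

open Block

-- Sortedness puts the copies of s in front: a head other than s would leave s with no occurrence.
-- After k copies are removed all remaining parts exceed s, so each occurs once and the order is
-- strict.
blockDecomposition : ∀ k {s ps} → AllPairs _≤_ ps → All (s ≤_) ps → occurrences s ps ≡ k →
  All (λ x → x ≢ s → occurrences x ps ≤ 1) ps →
  ∃ λ qs → ps ≡ replicate k s ++ qs × AllPairs _<_ qs × All (s <_) qs
blockDecomposition zero {s} {ps} sorted s≤ps occ once =
  ps , refl ,
  AllPairs.zipWith (λ (x≤y , x≢y) → ≤∧≢⇒< x≤y x≢y) (sorted , occurrences≤1⇒Unique
    (All.zipWith (λ (once , s<x) → once (>⇒≢ s<x)) (once , s<ps))) ,
  s<ps
  where
  s<ps : All (s <_) ps
  s<ps = All.tabulate λ {x} x∈ps → ≤∧≢⇒< (All.lookup s≤ps x∈ps)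
    λ { refl → <⇒≢ (occurrences-∈ x∈ps) (sym occ) }
blockDecomposition (suc k) {s} {p ∷ ps} (p≤ps ∷ sorted) (s≤p ∷ s≤ps) occ (_ ∷ once) with s ≟ p
... | no s≢p =
  contradiction (trans (sym (occurrences-none (s≢p ∷ All.map (λ p≤x → <⇒≢ (<-≤-trans (≤∧≢⇒< s≤p s≢p) p≤x)) p≤ps))) occ) λ ()
... | yes refl
  with qs , refl , inc , s<qs ← blockDecomposition k sorted s≤ps
         (suc-injective (trans (sym (occurrences-≡ s ps)) occ))
         (All.map (λ {x} once x≢s → ≤-trans (≤-reflexive (sym (occurrences-≢ ps x≢s))) (once x≢s)) once) =
  qs , refl , inc , s<qs

-- Enumeration by smallest part

blockLists : Parity → ℕ → ℕ → ℕ → ℕ → List (List ℕ)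
blockLists π k s f = shift [] (k * s) (map (replicate k s ++_) ∘ distinctLists π s f)

-- Runs through the smallest parts from s to s + f, with s + f bounding all parts, in step with
-- `diagonal`; its signed count is thus `smallestSum`.
dLists : Parity → ℕ → ℕ → ℕ → ℕ → List (List ℕ)
dLists π k s zero    n = blockLists π k s zero n
dLists π k s (suc f) n = blockLists π k s (suc f) n ++ dLists π k (suc s) f n

blockLists-signed : ∀ k s f n → signed (λ π → blockLists π k s f n) ≡ (q^ k * s · qProduct s f) n
blockLists-signed k s f n = trans
  (signed-shift (k * s) (λ π → map (replicate k s ++_) ∘ distinctLists π s f) n)
  (q^-cong (k * s) (λ m → trans (signed-map (replicate k s ++_) (λ π → distinctLists π s f m))
                                (distinctLists-signed s f m)) n)

dLists-signed : ∀ k s f n → signed (λ π → dLists π k s f n) ≡ smallestSum k s f n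
dLists-signed k s zero    n = blockLists-signed k s zero n
dLists-signed k s (suc f) n = trans
  (signed-++ (λ π → blockLists π k s (suc f) n) (λ π → dLists π k (suc s) f n))
  (cong₂ ℤ._+_ (blockLists-signed k s (suc f) n) (dLists-signed k (suc s) f n))

blockLists-sound : ∀ {π} k s f {n ps} → ps ∈ blockLists π (suc k) s f n →
                   IsDPartition (suc k) n s ps × parity (numberAbove s ps) ≡ π
blockLists-sound k s f {n} ps∈
  with m , refl , q ← ∈-shift⁻ (suc k * s) n ps∈
  with qs , qs∈ , refl ← ∈-map⁻ (replicate (suc k) s ++_) q
  with mkDistinct inc s<qs _ refl par ← distinctLists-sound s f qs∈ =
  block-isDPartition s<qs k inc , trans (cong parity (block-numberAbove s<qs (suc k))) par

-- The lower bound on the parts is carried along for the disjointness in `dLists-unique`.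
dLists-sound : ∀ {π} k s f {n ps} → ps ∈ dLists π (suc k) s f n →
               All (s ≤_) ps × DPartition π (suc k) n ps
dLists-sound k s zero ps∈ with d , par ← blockLists-sound k s zero ps∈ =
  IsDPartition.smallest d , s , d , par
dLists-sound {π} k s (suc f) {n} ps∈ with ∈-++⁻ (blockLists π (suc k) s (suc f) n) ps∈
... | inj₁ p with d , par ← blockLists-sound k s (suc f) p = IsDPartition.smallest d , s , d , par
... | inj₂ p with s<ps , d ← dLists-sound k (suc s) f p = All.map <⇒≤ s<ps , d

blockLists-complete : ∀ {π k s f n ps} → IsDPartition k n s ps → parity (numberAbove s ps) ≡ π →
                      All (_≤ s + f) ps → ps ∈ blockLists π k s f n
blockLists-complete {k = k} {s} {f} (isDPartition (isPartition sorted tot) _ s≤ps occ once) par le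
  with qs , refl , inc , s<qs ← blockDecomposition k (Sorted⇒AllPairs ≤-totalOrder sorted) s≤ps occ once
  with refl ← trans (sym (block-sum s<qs k)) tot =
  ∈-shift⁺ (k * s) (∈-map⁺ (replicate k s ++_) (distinctLists-complete s f (mkDistinct inc s<qs
    (All.++⁻ʳ (replicate k s) le) refl (trans (cong parity (sym (block-numberAbove s<qs k))) par))))

dLists-complete : ∀ {π k s′} s f {n ps} → s ≤ s′ → IsDPartition k n s′ ps → parity (numberAbove s′ ps) ≡ π →
                  All (_≤ s + f) ps → ps ∈ dLists π k s f n
dLists-complete {s′ = s′} s zero s≤s′ d par le
  -- An empty remaining range forces the smallest part to be s, as it is itself a part bounded by s
  -- + 0.
  with refl ← ≤-antisym s≤s′ (≤-trans (All.lookup le (IsDPartition.isPart d)) (≤-reflexive (+-identityʳ s))) =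
  blockLists-complete d par le
dLists-complete {π} {k} s (suc f) {n} s≤s′ d par le with m≤n⇒m<n∨m≡n s≤s′
... | inj₂ refl = ∈-++⁺ˡ (blockLists-complete d par le)
... | inj₁ s<s′ = ∈-++⁺ʳ (blockLists π k s (suc f) n)
  (dLists-complete (suc s) f s<s′ d par (All.map (λ {x} → subst (x ≤_) (+-suc s f)) le))

blockLists-unique : ∀ π k s f n → Unique (blockLists π k s f n)
blockLists-unique π k s f n = shift-unique (k * s) n λ m →
  Unique.map⁺ (++-cancelˡ (replicate k s) _ _) (distinctLists-unique π s f m)

dLists-unique : ∀ π k s f n → Unique (dLists π (suc k) s f n)
dLists-unique π k s zero    n = blockLists-unique π (suc k) s zero n
dLists-unique π k s (suc f) n = Unique.++⁺
  (blockLists-unique π (suc k) s (suc f) n) (dLists-unique π k (suc s) f n)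
  -- A list in the first piece contains s; every part in the second is at least s + 1.
  λ (p , q) → <-irrefl refl (All.lookup (proj₁ (dLists-sound k (suc s) f q))
                                        (IsDPartition.isPart (proj₁ (blockLists-sound k s (suc f) p))))

dEnumeration : ∀ π k n → Enumeration (DPartition π (suc k) n)
dEnumeration π k n = record
  -- Parts are at most n; the range is one longer to match the truncation at `suc M` in
  -- `smallestSum≡qProduct`, taken with M = n.
  { elements = dLists π (suc k) 0 (suc n) n
  ; unique   = dLists-unique π k 0 (suc n) n
  ; exact    = λ ps → mk⇔ (proj₂ ∘ dLists-sound k 0 (suc n)) λ (s , d , par) →
      dLists-complete 0 (suc n) z≤n d par (All.map m≤n⇒m≤1+n (parts≤n (IsDPartition.partition d)))
  }

Dᵉ-Dᵒ≡qProduct : ∀ k n → + Dᵉ (suc k) n - + Dᵒ (suc k) n ≡ qProduct 0 k n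
Dᵉ-Dᵒ≡qProduct k n = trans (cong₂ (λ a b → + a - + b) (size-D 0ℙ) (size-D 1ℙ))
  (trans (dLists-signed (suc k) 0 (suc n) n) (smallestSum≡qProduct k n n ≤-refl))
  where
  size-D : ∀ π → size (dPartitions π (suc k) n) ≡ length (dLists π (suc k) 0 (suc n) n)
  size-D π = enumeration-size (dPartitions π (suc k) n) (dEnumeration π k n) (λ _ → mk⇔ id id)

-- The coefficient formula in its three cases

theorem8 : (k : ℕ) → .{{_ : NonZero k}} → (n : ℕ) → 1 ≤ n →
    ((m : ℤ) → Pentagonal n m → n ≤ k ∸ 1 →
    + Dᵉ k n - + Dᵒ k n ≡ -1ℤ ^ ∣ m ∣)
    × (k ∸ 1 < n → 2 * n ≤ k * (k ∸ 1) →
    + Dᵉ k n - + Dᵒ k n ≡ + Pₑ k n - + Pₒ k n)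
    × (¬ (∃ λ (m : ℤ) → Pentagonal n m × n ≤ k ∸ 1) →
    ¬ (k ∸ 1 < n × 2 * n ≤ k * (k ∸ 1)) →
    + Dᵉ k n - + Dᵒ k n ≡ 0ℤ)
theorem8 (suc k) n 1≤n =
    (λ m pent n≤k → let p = Pentagonal⇒IsPent m pent in
      trans (Dᵉ-Dᵒ≡qProduct k n) (trans (qProduct-pentagonal n≤k)
        (pentagonalSum-≡ k 1≤n (≤-trans (IsPent⇒≤ ∣ m ∣ p) n≤k) p)))
  , (λ _ _ → trans (Dᵉ-Dᵒ≡qProduct k n) (sym (Pₑ-Pₒ≡qProduct (suc k) n)))
  , (λ ¬pent ¬mid → trans (Dᵉ-Dᵒ≡qProduct k n) (vanish ¬pent ¬mid))
  where
  vanish : ¬ (∃ λ (m : ℤ) → Pentagonal n m × n ≤ k) → ¬ (k < n × 2 * n ≤ suc k * k) → qProduct 0 k n ≡ 0ℤ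
  vanish ¬pent ¬mid with n ≤? k
  ... | yes n≤k = trans (qProduct-pentagonal n≤k)
    (pentagonalSum-≢ k 1≤n λ j _ p → ¬pent (+ j , IsPent⇒Pentagonal j p , n≤k))
  -- Beyond k, failure of the middle case means k(k + 1) < 2n, so n exceeds the degree `triangle k`
  -- of the product.
  ... | no n≰k  = qProduct-degree k n (*-cancelˡ-< 2 _ _
    (subst (_< 2 * n) (sym (double-triangle k)) (≰⇒> (λ 2n≤ → ¬mid (≰⇒> n≰k , 2n≤)))))
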